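{- Let $r\geq 2$ and let $(P,\mathcal{L})$ be an $r$-uniform linear system with $|\mathcal{L}|>\nu_2(P,\mathcal{L})$. If $\nu_2(P,\mathcal{L})=4$, then $$\tau(P,\mathcal{L})\leq \frac{|P|+|\mathcal{L}|}{r+1}.$$
   Context: A linear system is a pair $(P,\mathcal{L})$ where $P$ is a finite set (points) and $\mathcal{L}$ is a family of subsets of $P$ (lines) such that $|l\cap l'|\leq 1$ for all distinct $l,l'\in\mathcal{L}$. It is $r$-uniform if every line has exactly $r$ points. A transversal is a set $T\subseteq P$ meeting every line; $\tau(P,\mathcal{L})$ is the minimum size of a transversal. A 2-packing is a set $R\subseteq\mathcal{L}$ of lines such that no three lines of $R$ have a common point; $\nu_2(P,\mathcal{L})$ is the maximum size of a 2-packing. -}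

module Defs where

open import Data.Nat using (ℕ; _≤_)
open import Data.Fin using (Fin)
open import Data.Fin.Subset using (Subset; _∈_; _∉_; _∩_; ∣_∣)
open import Data.Product using (Σ; _×_; ∃)
open import Relation.Binary.PropositionalEquality using (_≡_; _≢_)
open import Relation.Nullary using (¬_)
open import Function.Definitions using (Injective)

-- A linear system on the point set P = Fin n with m lines, given as an
-- injective family of subsets L : Fin m → Subset n (so 𝓛 is a set of m
-- distinct lines), any two distinct lines sharing at most one point.
IsLinear : {n m : ℕ} → (Fin m → Subset n) → Set
IsLinear {n} {m} L =
  Injective _≡_ _≡_ L × (∀ (i j : Fin m) → i ≢ j → ∣ L i ∩ L j ∣ ≤ 1)

IsUniform : {n m : ℕ} → ℕ → (Fin m → Subset n) → Set
IsUniform {n} {m} r L = ∀ (i : Fin m) → ∣ L i ∣ ≡ r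

IsTransversal : {n m : ℕ} → (Fin m → Subset n) → Subset n → Set
IsTransversal {n} {m} L T = ∀ (i : Fin m) → ∃ λ (p : Fin n) → p ∈ T × p ∈ L i

Isτ : {n m : ℕ} → (Fin m → Subset n) → ℕ → Set
Isτ {n} {m} L t =
  (Σ (Subset n) λ T → IsTransversal L T × ∣ T ∣ ≡ t)
  × (∀ (T : Subset n) → IsTransversal L T → t ≤ ∣ T ∣)

IsTwoPacking : {n m : ℕ} → (Fin m → Subset n) → Subset m → Set
IsTwoPacking {n} {m} L R =
  ∀ (i j k : Fin m) → i ∈ R → j ∈ R → k ∈ R → i ≢ j → i ≢ k → j ≢ k →
    ∀ (p : Fin n) → ¬ (p ∈ L i × p ∈ L j × p ∈ L k)

Isν₂ : {n m : ℕ} → (Fin m → Subset n) → ℕ → Set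
Isν₂ {n} {m} L k =
  (Σ (Subset m) λ R → IsTwoPacking L R × ∣ R ∣ ≡ k)
  × (∀ (R : Subset m) → IsTwoPacking L R → ∣ R ∣ ≤ k)

{-# OPTIONS --safe #-}
module Submission where

-- Any five lines contain three concurrent ones, so some point p lies on at least three lines;
-- these already cover 3r − 2 points, which gives the bound when τ ≤ 3.
--
-- If the lines off p form a 2-packing (of at most four lines a, b, c, d), then τ ≤ 3: every line
-- through p passes through a meeting point of two of the four.  Unless two disjoint pairs among
-- them meet, the meeting pairs form a star, whose three points are a transversal, or a triangle
-- missing one line, and then there is a 2-packing of five lines.
--
-- Otherwise some q lies on three lines y₁, y₂, y₃ off p.  Take x₁, x₂ through p and not through q.
-- Applying the five-line property to x₁, x₂, yᵢ, yⱼ, u shows that every line u off p and q meets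
-- x₁ on some yᵢ, and that y₁, y₂, y₃ are then the only lines through q off p.  Hence p and the
-- points x₁ ∩ yᵢ form a transversal and τ ≤ 4.  If τ = 4 there are at least two lines c, d off p and
-- q, which do not meet or are not the only ones; counting points on c, d, x₁, x₂ and q gives
-- |P| ≥ 4r − 4 with |𝓛| ≥ 8 in the first case and |P| ≥ 4r − 5 with |𝓛| ≥ 9 in the second.

open import Defs
open import Data.Nat using (ℕ; _≤_; _<_; _+_; _*_; suc)
open import Data.Fin using (Fin)
open import Data.Fin.Subset using (Subset)

open import Data.Nat using (z≤n; s≤s; s≤s⁻¹)
open import Data.Nat.Properties using (≤-trans; ≤-reflexive; +-suc; +-comm; +-monoˡ-≤; +-monoʳ-≤; +-mono-≤; *-monoˡ-≤; m≤m+n; 1+n≰n; module ≤-Reasoning)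
open import Data.Nat.Tactic.RingSolver using (solve-∀)
open import Data.Fin.Properties using (any?; _≟_)
open import Data.Fin.Subset using (_∈_; _∉_; _∪_; _∩_; ⁅_⁆; ⋃; ∣_∣; Nonempty; inside; outside)
open import Data.Fin.Subset.Properties using (_∈?_; nonempty?; Empty-unique; ∉⊥; ∣⊥∣≡0; ∣⊤∣≡n; ∣⁅x⁆∣≡1; x∈⁅x⁆; x∈⁅y⁆⇒x≡y; x∈p∪q⁺; x∈p∪q⁻; x∈p∩q⁺; x∈p∩q⁻; p⊆q⇒∣p∣≤∣q∣; ∣p∣≤n; ∩-distribˡ-∪)
open import Data.Vec using ([]; _∷_)
open import Data.List using (List; []; _∷_; length; map)
open import Data.List.Relation.Unary.All as All using (All; []; _∷_)
open import Data.List.Relation.Unary.Any using (here; there)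
open import Data.List.Relation.Unary.AllPairs as AllPairs using (AllPairs; []; _∷_)
open import Data.List.Relation.Unary.Unique.Propositional using (Unique)
open import Data.List.Relation.Unary.Unique.Propositional.Properties using (++⁺)
open import Data.List.Membership.Propositional using () renaming (_∈_ to _∈ₗ_; _∉_ to _∉ₗ_)
open import Data.List.Relation.Unary.All.Properties using () renaming (++⁺ to All-++⁺)
import Data.Fin.Subset as Subset
import Data.List.Membership.DecPropositional as DecMembership
open import Data.Product using (_×_; _,_; proj₁; proj₂; ∃)
open import Data.Sum using (_⊎_; inj₁; inj₂)
open import Data.Unit using (⊤)
open import Data.Empty using (⊥; ⊥-elim)
open import Relation.Nullary using (¬_; Dec; yes; no; ¬?; _×-dec_)
open import Relation.Nullary.Decidable using (decidable-stable)
open import Relation.Unary using (Decidable)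
open import Relation.Binary.PropositionalEquality using (_≡_; _≢_; refl; sym; trans; cong; cong₂; subst; ≢-sym)

-- Cardinalities of unions and intersections of finite subsets.

∣p∪q∣+∣p∩q∣≡∣p∣+∣q∣ : ∀ {n} (p q : Subset n) → ∣ p ∪ q ∣ + ∣ p ∩ q ∣ ≡ ∣ p ∣ + ∣ q ∣
∣p∪q∣+∣p∩q∣≡∣p∣+∣q∣ [] [] = refl
∣p∪q∣+∣p∩q∣≡∣p∣+∣q∣ (outside ∷ p) (outside ∷ q) = ∣p∪q∣+∣p∩q∣≡∣p∣+∣q∣ p q
∣p∪q∣+∣p∩q∣≡∣p∣+∣q∣ (outside ∷ p) (inside ∷ q) =
  trans (cong suc (∣p∪q∣+∣p∩q∣≡∣p∣+∣q∣ p q)) (sym (+-suc ∣ p ∣ ∣ q ∣))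
∣p∪q∣+∣p∩q∣≡∣p∣+∣q∣ (inside ∷ p) (outside ∷ q) = cong suc (∣p∪q∣+∣p∩q∣≡∣p∣+∣q∣ p q)
∣p∪q∣+∣p∩q∣≡∣p∣+∣q∣ (inside ∷ p) (inside ∷ q) =
  cong suc (trans (+-suc ∣ p ∪ q ∣ ∣ p ∩ q ∣)
    (trans (cong suc (∣p∪q∣+∣p∩q∣≡∣p∣+∣q∣ p q)) (sym (+-suc ∣ p ∣ ∣ q ∣))))

∣p∪q∣≤∣p∣+∣q∣ : ∀ {n} (p q : Subset n) → ∣ p ∪ q ∣ ≤ ∣ p ∣ + ∣ q ∣
∣p∪q∣≤∣p∣+∣q∣ p q = ≤-trans (m≤m+n _ _) (≤-reflexive (∣p∪q∣+∣p∩q∣≡∣p∣+∣q∣ p q))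

∣p∣+∣q∣≤∣p∪q∣+k : ∀ {n k} (p q : Subset n) → ∣ p ∩ q ∣ ≤ k → ∣ p ∣ + ∣ q ∣ ≤ ∣ p ∪ q ∣ + k
∣p∣+∣q∣≤∣p∪q∣+k p q h =
  ≤-trans (≤-reflexive (sym (∣p∪q∣+∣p∩q∣≡∣p∣+∣q∣ p q))) (+-monoʳ-≤ ∣ p ∪ q ∣ h)

∣p∩[q∪s]∣≤j+k : ∀ {n j k} (p q s : Subset n) → ∣ p ∩ q ∣ ≤ j → ∣ p ∩ s ∣ ≤ k → ∣ p ∩ (q ∪ s) ∣ ≤ j + k
∣p∩[q∪s]∣≤j+k p q s hj hk = ≤-trans (≤-reflexive (cong ∣_∣ (∩-distribˡ-∪ p q s)))
  (≤-trans (∣p∪q∣≤∣p∣+∣q∣ (p ∩ q) (p ∩ s)) (+-mono-≤ hj hk))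

empty⇒∣p∣≤0 : ∀ {n} {p : Subset n} → ¬ Nonempty p → ∣ p ∣ ≤ 0
empty⇒∣p∣≤0 {n} e = ≤-reflexive (trans (cong ∣_∣ (Empty-unique e)) (∣⊥∣≡0 n))

-- Finite subsets given by lists of their elements.

fromList : ∀ {n} → List (Fin n) → Subset n
fromList xs = ⋃ (map ⁅_⁆ xs)

∈-fromList⁺ : ∀ {n} {x : Fin n} {xs} → x ∈ₗ xs → x ∈ fromList xs
∈-fromList⁺ (here refl) = x∈p∪q⁺ (inj₁ (x∈⁅x⁆ _))
∈-fromList⁺ (there x∈) = x∈p∪q⁺ (inj₂ (∈-fromList⁺ x∈))

∈-fromList⁻ : ∀ {n} {x : Fin n} xs → x ∈ fromList xs → x ∈ₗ xs
∈-fromList⁻ [] x∈ = ⊥-elim (∉⊥ x∈)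
∈-fromList⁻ (y ∷ xs) x∈ with x∈p∪q⁻ ⁅ y ⁆ (fromList xs) x∈
... | inj₁ h = here (x∈⁅y⁆⇒x≡y y h)
... | inj₂ h = there (∈-fromList⁻ xs h)

∣fromList∣≤length : ∀ {n} (xs : List (Fin n)) → ∣ fromList xs ∣ ≤ length xs
∣fromList∣≤length {n} [] = ≤-reflexive (∣⊥∣≡0 n)
∣fromList∣≤length (x ∷ xs) = ≤-trans (∣p∪q∣≤∣p∣+∣q∣ ⁅ x ⁆ (fromList xs))
  (+-mono-≤ (≤-reflexive (∣⁅x⁆∣≡1 x)) (∣fromList∣≤length xs))

length≤∣fromList∣ : ∀ {n} {xs : List (Fin n)} → Unique xs → length xs ≤ ∣ fromList xs ∣
length≤∣fromList∣ [] = z≤n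
length≤∣fromList∣ {xs = x ∷ xs} (x∉ ∷ u) = begin
  1 + length xs                     ≤⟨ +-mono-≤ (≤-reflexive (sym (∣⁅x⁆∣≡1 x))) (length≤∣fromList∣ u) ⟩
  ∣ ⁅ x ⁆ ∣ + ∣ fromList xs ∣       ≤⟨ ∣p∣+∣q∣≤∣p∪q∣+k ⁅ x ⁆ (fromList xs) (empty⇒∣p∣≤0 disjoint) ⟩
  ∣ ⁅ x ⁆ ∪ fromList xs ∣ + 0       ≡⟨ +-comm _ 0 ⟩
  ∣ ⁅ x ⁆ ∪ fromList xs ∣           ∎
  where
  open ≤-Reasoning
  disjoint : ¬ Nonempty (⁅ x ⁆ ∩ fromList xs)
  disjoint (y , y∈) with x∈p∩q⁻ ⁅ x ⁆ (fromList xs) y∈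
  ... | y∈x , y∈xs = All.lookup x∉ (∈-fromList⁻ xs y∈xs) (sym (x∈⁅y⁆⇒x≡y x y∈x))

unique⇒length≤ : ∀ {n} {xs : List (Fin n)} → Unique xs → length xs ≤ n
unique⇒length≤ {xs = xs} u = ≤-trans (length≤∣fromList∣ u) (∣p∣≤n (fromList xs))

AllPairs-lookup : ∀ {A : Set} {R : A → A → Set} {xs x y} → (∀ {i j} → R i j → R j i) →
  AllPairs R xs → x ∈ₗ xs → y ∈ₗ xs → x ≢ y → R x y
AllPairs-lookup s (_ ∷ _)  (here refl) (here refl) x≢y = ⊥-elim (x≢y refl)
AllPairs-lookup s (r ∷ _)  (here refl) (there y∈) _ = All.lookup r y∈
AllPairs-lookup s (r ∷ _)  (there x∈) (here refl) _ = s (All.lookup r x∈)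
AllPairs-lookup s (_ ∷ rs) (there x∈) (there y∈) x≢y = AllPairs-lookup s rs x∈ y∈ x≢y

-- Applied again and again to the list found so far, this enumerates the elements satisfying `P`
-- until the list is complete or long enough for a contradiction or a count.
findOutside : ∀ {n} {P : Fin n → Set} → Decidable P → (xs : List (Fin n)) →
  (∃ λ w → P w × w ∉ₗ xs) ⊎ (∀ w → P w → w ∈ₗ xs)
findOutside P? xs with any? (λ w → P? w ×-dec ¬? (w ∈ₗ? xs))
  where open DecMembership _≟_ using () renaming (_∈?_ to _∈ₗ?_)
... | yes found = inj₁ found
... | no  none  = inj₂ λ w Pw → decidable-stable (w ∈ₗ? xs) λ w∉ → none (w , Pw , w∉)
  where open DecMembership _≟_ using () renaming (_∈?_ to _∈ₗ?_)

∉⇒All≢ : ∀ {A : Set} {w : A} {xs} → w ∉ₗ xs → All (w ≢_) xs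
∉⇒All≢ {xs = []} _ = []
∉⇒All≢ {xs = x ∷ xs} w∉ = (λ eq → w∉ (here eq)) ∷ ∉⇒All≢ (λ w∈ → w∉ (there w∈))

pattern #0 = here refl
pattern #1 = there (here refl)
pattern #2 = there (there (here refl))
pattern #3 = there (there (there (here refl)))

-- Meeting points, pencils and 2-packings in a linear system.

module LinearSystem {n m : ℕ} (L : Fin m → Subset n)
  (L∩L≤1 : ∀ i j → i ≢ j → ∣ L i ∩ L j ∣ ≤ 1) where

  Meet : Fin m → Fin m → Set
  Meet i j = ∃ λ p → p ∈ L i × p ∈ L j

  meet? : ∀ i j → Dec (Meet i j)
  meet? i j = any? λ p → (p ∈? L i) ×-dec (p ∈? L j)

  ¬Meet-sym : ∀ {i j} → ¬ Meet i j → ¬ Meet j i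
  ¬Meet-sym ¬ij (p , pj , pi) = ¬ij (p , pi , pj)

  Concurrent : Fin m → Fin m → Fin m → Set
  Concurrent i j k = ∃ λ p → p ∈ L i × p ∈ L j × p ∈ L k

  concurrent? : ∀ i j k → Dec (Concurrent i j k)
  concurrent? i j k = any? λ p → (p ∈? L i) ×-dec ((p ∈? L j) ×-dec (p ∈? L k))

  meet-unique : ∀ {i j p q} → i ≢ j → p ∈ L i → p ∈ L j → q ∈ L i → q ∈ L j → p ≡ q
  meet-unique {i} {j} {p} {q} i≢j pi pj qi qj with p ≟ q
  ... | yes p≡q = p≡q
  ... | no  p≢q = ⊥-elim (1+n≰n (≤-trans (length≤∣fromList∣ ((p≢q ∷ []) ∷ [] ∷ []))
                    (≤-trans (p⊆q⇒∣p∣≤∣q∣ pq⊆) (L∩L≤1 i j i≢j))))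
    where
    pq⊆ : ∀ {x} → x ∈ fromList (p ∷ q ∷ []) → x ∈ L i ∩ L j
    pq⊆ x∈ with ∈-fromList⁻ (p ∷ q ∷ []) x∈
    ... | #0 = x∈p∩q⁺ (pi , pj)
    ... | #1 = x∈p∩q⁺ (qi , qj)

  separated : ∀ {p i j} → p ∈ L i → p ∉ L j → i ≢ j
  separated pi p∉j refl = p∉j pi

  -- The lines i and j have no common point but p, and k misses p. Most of the non-concurrent
  -- triples in the packings below arise this way.
  meet-avoids : ∀ {p i j k} → p ∈ L i → p ∈ L j → i ≢ j → p ∉ L k →
    ∀ {q} → q ∈ L i → q ∈ L j → q ∉ L k
  meet-avoids pi pj i≢j p∉k qi qj qk = p∉k (subst (_∈ L _) (meet-unique i≢j qi qj pi pj) qk)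

  -- The predicate `P` restricts the lines considered, so that the second pencil can be sought among
  -- the lines off the centre of the first.
  record Pencil (P : Fin m → Set) : Set where
    constructor pencil
    field
      {centre}   : Fin n
      {x₁ x₂ x₃} : Fin m
      distinct   : Unique (x₁ ∷ x₂ ∷ x₃ ∷ [])
      through    : All (λ i → centre ∈ L i) (x₁ ∷ x₂ ∷ x₃ ∷ [])
      inside-P   : All P (x₁ ∷ x₂ ∷ x₃ ∷ [])

  findPencil : ∀ {P} → Decidable P →
    Pencil P ⊎ (∀ {i j k} → P i → P j → P k → i ≢ j → i ≢ k → j ≢ k → ¬ Concurrent i j k)
  findPencil P?
    with any? (λ i → any? λ j → any? λ k → (P? i ×-dec P? j ×-dec P? k) ×-dec
           (¬? (i ≟ j) ×-dec ¬? (i ≟ k) ×-dec ¬? (j ≟ k)) ×-dec concurrent? i j k)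
  ... | yes (i , j , k , (Pi , Pj , Pk) , (i≢j , i≢k , j≢k) , p , pi , pj , pk) =
        inj₁ (pencil ((i≢j ∷ i≢k ∷ []) ∷ (j≢k ∷ []) ∷ [] ∷ []) (pi ∷ pj ∷ pk ∷ []) (Pi ∷ Pj ∷ Pk ∷ []))
  ... | no none = inj₂ λ Pi Pj Pk i≢j i≢k j≢k conc →
        none (_ , _ , _ , (Pi , Pj , Pk) , (i≢j , i≢k , j≢k) , conc)

  -- Each head is tested only against the pairs in its tail, so every triple of entries is checked
  -- once, and adding a line to a packing costs only the pairs of the old lines.
  Packing : List (Fin m) → Set
  Packing []       = ⊤
  Packing (e ∷ xs) = AllPairs (λ i j → ¬ Concurrent i j e) xs × Packing xs

  -- Concurrency is symmetric, so if one of the three lines is the head it can be moved to the last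
  -- place; two of them at the head would coincide.
  Packing⇒¬Concurrent : ∀ {xs i j k} → Packing xs → i ∈ₗ xs → j ∈ₗ xs → k ∈ₗ xs →
    i ≢ j → i ≢ k → j ≢ k → ¬ Concurrent i j k
  Packing⇒¬Concurrent {e ∷ xs} (new , old) = λ where
      #0 #0 _ i≢j _ _ → ⊥-elim (i≢j refl)
      #0 (there _) #0 _ i≢k _ → ⊥-elim (i≢k refl)
      (there _) #0 #0 _ _ j≢k → ⊥-elim (j≢k refl)
      (there i∈) (there j∈) #0 i≢j _ _ → pair i∈ j∈ i≢j
      (there i∈) #0 (there k∈) _ i≢k _ (p , pi , pj , pk) → pair i∈ k∈ i≢k (p , pi , pk , pj)
      #0 (there j∈) (there k∈) _ _ j≢k (p , pi , pj , pk) → pair j∈ k∈ j≢k (p , pj , pk , pi)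
      (there i∈) (there j∈) (there k∈) → Packing⇒¬Concurrent old i∈ j∈ k∈
    where
    pair : ∀ {i j} → i ∈ₗ xs → j ∈ₗ xs → i ≢ j → ¬ Concurrent i j e
    pair = AllPairs-lookup {R = λ i j → ¬ Concurrent i j e} (λ f (p , pi , pj , pe) → f (p , pj , pi , pe)) new

  Packing⇒IsTwoPacking : ∀ {xs} → Packing xs → IsTwoPacking L (fromList xs)
  Packing⇒IsTwoPacking {xs} pk i j k i∈ j∈ k∈ i≢j i≢k j≢k p conc = Packing⇒¬Concurrent pk
    (∈-fromList⁻ xs i∈) (∈-fromList⁻ xs j∈) (∈-fromList⁻ xs k∈) i≢j i≢k j≢k (p , conc)

  -- Transversals given by lists of points.

  Hits : List (Fin n) → Fin m → Set
  Hits T i = ∃ λ p → p ∈ₗ T × p ∈ L i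

  Covers : List (Fin n) → Set
  Covers T = ∀ i → Hits T i

  τ≤length : ∀ {t T} → Isτ L t → Covers T → t ≤ length T
  τ≤length {T = T} (_ , minimal) c = ≤-trans (minimal (fromList T) transversal) (∣fromList∣≤length T)
    where
    transversal : IsTransversal L (fromList T)
    transversal i with c i
    ... | p , p∈T , pi = p , ∈-fromList⁺ p∈T , pi

  -- The list may repeat points, so a smaller transversal can be padded; only the bound τ ≤ k is
  -- recorded.
  CoveredBy : ℕ → Set
  CoveredBy k = ∃ λ T → length T ≡ k × Covers T

  -- Consequences of uniformity and of ν₂ ≤ 4.

  module Uniform {r : ℕ} (1≤r : 1 ≤ r) (unif : IsUniform r L)
    (ν₂≤4 : ∀ R → IsTwoPacking L R → ∣ R ∣ ≤ 4) where

    point : ∀ i → ∃ λ p → p ∈ L i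
    point i with nonempty? (L i)
    ... | yes h = h
    ... | no ¬h = ⊥-elim (1+n≰n (≤-trans 1≤r (≤-trans (≤-reflexive (sym (unif i))) (empty⇒∣p∣≤0 ¬h))))

    -- The point is the intersection if the lines meet and an arbitrary point of `L j` otherwise.
    -- Transversals can thus be written down without deciding which lines meet.
    pointTowards : ∀ i j → i ≢ j → ∃ λ p → p ∈ L j × (∀ q → q ∈ L i → q ∈ L j → q ≡ p)
    pointTowards i j i≢j with meet? i j
    ... | yes (p , pi , pj) = p , pj , λ q qi qj → meet-unique i≢j qi qj pi pj
    ... | no  ¬m = proj₁ (point j) , proj₂ (point j) , λ q qi qj → ⊥-elim (¬m (q , qi , qj))

    ¬Packing₅ : ∀ {a b c d e} → Unique (a ∷ b ∷ c ∷ d ∷ e ∷ []) → ¬ Packing (a ∷ b ∷ c ∷ d ∷ e ∷ [])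
    ¬Packing₅ u pk = 1+n≰n (≤-trans (length≤∣fromList∣ u) (ν₂≤4 _ (Packing⇒IsTwoPacking pk)))

    -- Otherwise e would extend the packing of four lines to a packing of five.
    throughPair : ∀ {a b c d e} → Unique (e ∷ a ∷ b ∷ c ∷ d ∷ []) → Packing (a ∷ b ∷ c ∷ d ∷ []) →
      Concurrent a b e ⊎ Concurrent a c e ⊎ Concurrent a d e ⊎
      Concurrent b c e ⊎ Concurrent b d e ⊎ Concurrent c d e
    throughPair {a} {b} {c} {d} {e} u pk with concurrent? a b e
    ... | yes h = inj₁ h
    ... | no ab with concurrent? a c e
    ... | yes h = inj₂ (inj₁ h)
    ... | no ac with concurrent? a d e
    ... | yes h = inj₂ (inj₂ (inj₁ h))
    ... | no ad with concurrent? b c e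
    ... | yes h = inj₂ (inj₂ (inj₂ (inj₁ h)))
    ... | no bc with concurrent? b d e
    ... | yes h = inj₂ (inj₂ (inj₂ (inj₂ (inj₁ h))))
    ... | no bd with concurrent? c d e
    ... | yes h = inj₂ (inj₂ (inj₂ (inj₂ (inj₂ h))))
    ... | no cd = ⊥-elim (¬Packing₅ u
            (((ab ∷ ac ∷ ad ∷ []) ∷ (bc ∷ bd ∷ []) ∷ (cd ∷ []) ∷ [] ∷ []) , pk))

    -- First case: the lines off p form a 2-packing.

    module OffPacking {p x y} (px : p ∈ L x) (py : p ∈ L y) (x≢y : x ≢ y)
      (offPacking : ∀ {i j k} → p ∉ L i → p ∉ L j → p ∉ L k → i ≢ j → i ≢ k → j ≢ k → ¬ Concurrent i j k)
      where

      Off : Fin m → Set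
      Off i = p ∉ L i

      off? : Decidable Off
      off? i = ¬? (p ∈? L i)

      off⇒Packing : ∀ {xs} → All Off xs → Unique xs → Packing xs
      off⇒Packing [] [] = _
      off⇒Packing {e ∷ _} (oe ∷ os) (e≢ ∷ u) = pairs os e≢ u , off⇒Packing os u
        where
        pairs : ∀ {xs} → All Off xs → All (e ≢_) xs → Unique xs → AllPairs (λ i j → ¬ Concurrent i j e) xs
        pairs [] [] [] = []
        pairs (oi ∷ os) (e≢i ∷ e≢) (i≢ ∷ u) =
          All.tabulate (λ j∈ → offPacking oi (All.lookup os j∈) oe (All.lookup i≢ j∈)
                                 (≢-sym e≢i) (≢-sym (All.lookup e≢ j∈)))
          ∷ pairs os e≢ u

      coverFromOff : ∀ {T xs} → (∀ w → Off w → w ∈ₗ xs) → p ∈ₗ T → All (Hits T) xs → Covers T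
      coverFromOff all p∈T hits w with p ∈? L w
      ... | yes pw = p , p∈T , pw
      ... | no  ow = All.lookup hits (all w ow)

      record Quad (a b c d : Fin m) : Set where
        field
          unique : Unique (a ∷ b ∷ c ∷ d ∷ [])
          off    : All Off (a ∷ b ∷ c ∷ d ∷ [])
          all    : ∀ w → Off w → w ∈ₗ a ∷ b ∷ c ∷ d ∷ []

        through : ∀ {w} → p ∈ L w →
          Concurrent a b w ⊎ Concurrent a c w ⊎ Concurrent a d w ⊎
          Concurrent b c w ⊎ Concurrent b d w ⊎ Concurrent c d w
        through pw = throughPair (All.map (separated pw) off ∷ unique) (off⇒Packing off unique)

      -- Cyclic shifts suffice for the symmetry, since `star` and `triangle` each single out only
      -- the first line.
      rotate : ∀ {a b c d} → Quad a b c d → Quad b c d a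
      rotate record { unique = (ab ∷ ac ∷ ad ∷ []) ∷ (bc ∷ bd ∷ []) ∷ (cd ∷ []) ∷ [] ∷ []
                    ; off = oa ∷ ob ∷ oc ∷ od ∷ [] ; all = all } = record
        { unique = (bc ∷ bd ∷ ≢-sym ab ∷ []) ∷ (cd ∷ ≢-sym ac ∷ []) ∷ (≢-sym ad ∷ []) ∷ [] ∷ []
        ; off = ob ∷ oc ∷ od ∷ oa ∷ []
        ; all = λ w ow → All.lookup {P = _∈ₗ _} (#3 ∷ #0 ∷ #1 ∷ #2 ∷ []) (all w ow)
        }

      -- Every line through p passes through a meeting point of two of the four lines, and each such
      -- point lies on a, hence is one of the three chosen points.
      star : ∀ {a b c d} → Quad a b c d → ¬ Meet b c → ¬ Meet b d → ¬ Meet c d → CoveredBy 3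
      star {a} {b} {c} {d} quad ¬bc ¬bd ¬cd
        with Quad.unique quad
      ... | (a≢b ∷ a≢c ∷ a≢d ∷ []) ∷ _
        with pointTowards a b a≢b | pointTowards a c a≢c | pointTowards a d a≢d
      ... | β , β∈b , β! | γ , γ∈c , γ! | δ , δ∈d , δ! =
        T , refl , covers
        where
        T = β ∷ γ ∷ δ ∷ []

        hits : ∀ {w} → p ∈ L w → Hits T a × Hits T w
        hits pw with Quad.through quad pw
        ... | inj₁ (q , qa , qb , qw) =
              (q , here (β! q qa qb) , qa) , (q , here (β! q qa qb) , qw)
        ... | inj₂ (inj₁ (q , qa , qc , qw)) =
              (q , there (here (γ! q qa qc)) , qa) , (q , there (here (γ! q qa qc)) , qw)
        ... | inj₂ (inj₂ (inj₁ (q , qa , qd , qw))) =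
              (q , there (there (here (δ! q qa qd))) , qa) , (q , there (there (here (δ! q qa qd))) , qw)
        ... | inj₂ (inj₂ (inj₂ (inj₁ (q , qb , qc , _)))) = ⊥-elim (¬bc (q , qb , qc))
        ... | inj₂ (inj₂ (inj₂ (inj₂ (inj₁ (q , qb , qd , _))))) = ⊥-elim (¬bd (q , qb , qd))
        ... | inj₂ (inj₂ (inj₂ (inj₂ (inj₂ (q , qc , qd , _))))) = ⊥-elim (¬cd (q , qc , qd))

        covers : Covers T
        covers w with p ∈? L w
        ... | yes pw = proj₂ (hits pw)
        -- The line a is hit because x, being a line through p, passes through one of the three
        -- points on a.
        ... | no  ow = All.lookup (proj₁ (hits px) ∷ (β , #0 , β∈b) ∷ (γ , #1 , γ∈c) ∷ (δ , #2 , δ∈d) ∷ [])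
                         (Quad.all quad w ow)

      -- The lines a, b, d, y, z form a 2-packing: d avoids a and b, while y and z meet only in p.
      triangle-step : ∀ {a b c d} → Off a → Off b → Off c → Off d →
        a ≢ b → a ≢ c → b ≢ c → a ≢ d → b ≢ d → ¬ Meet d a → ¬ Meet d b →
        ∀ {y z} → p ∈ L y → p ∈ L z → y ≢ z → Concurrent a c y → Concurrent b c z → ⊥
      triangle-step {a} {b} {c} oa ob oc od ab ac bc ad bd ¬da ¬db
        {y} {z} py pz y≢z (β , βa , βc , βy) (γ , γb , γc , γz) =
        ¬Packing₅
          ( (≢-sym y≢z ∷ separated pz ob ∷ separated pz oa ∷ separated pz od ∷ [])
          ∷ (separated py ob ∷ separated py oa ∷ separated py od ∷ [])
          ∷ (≢-sym ab ∷ bd ∷ []) ∷ (ad ∷ []) ∷ [] ∷ [])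
          ( ( ((λ (q , qy , qb , qz) → yz ob qy qz qb) ∷ (λ (q , qy , qa , qz) → yz oa qy qz qa)
                ∷ (λ (q , qy , qd , qz) → yz od qy qz qd) ∷ [])
            ∷ (abz ∷ (λ (q , qb , qd , _) → ¬db (q , qd , qb)) ∷ [])
            ∷ ((λ (q , qa , qd , _) → ¬da (q , qd , qa)) ∷ []) ∷ [] ∷ [])
          , ( (aby ∷ (λ (q , qb , qd , _) → ¬db (q , qd , qb)) ∷ [])
            ∷ ((λ (q , qa , qd , _) → ¬da (q , qd , qa)) ∷ []) ∷ [] ∷ [])
          , ( ((λ (q , qa , qd , _) → ¬da (q , qd , qa)) ∷ []) ∷ [] ∷ [])
          , ([] ∷ []) , [] , _)
        where
        yz : ∀ {k} → Off k → ∀ {q} → q ∈ L y → q ∈ L z → q ∉ L k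
        yz = meet-avoids py pz y≢z

        abc : ¬ Concurrent a b c
        abc = offPacking oa ob oc ab ac bc

        abz : ¬ Concurrent b a z
        abz (q , qb , qa , qz) with meet-unique (separated pz ob) qz qb γz γb
        ... | refl = abc (q , qa , qb , γc)

        aby : ¬ Concurrent b a y
        aby (q , qb , qa , qy) with meet-unique (separated py oa) qy qa βy βa
        ... | refl = abc (q , qa , qb , βc)

      -- Since d meets none of the others, x and y each pass through a vertex of the triangle a, b,
      -- c. The vertices differ because x and y meet only in p, so they lie on a common side, and
      -- `triangle-step` applies with that side as its c.
      triangle : ∀ {d a b c} → Quad d a b c → ¬ Meet d a → ¬ Meet d b → ¬ Meet d c → ⊥
      triangle {d} {a} {b} {c} quad ¬da ¬db ¬dc = go (sides px) (sides py)
        where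
        Sides : Fin m → Set
        Sides w = Concurrent a b w ⊎ Concurrent a c w ⊎ Concurrent b c w

        sides : ∀ {w} → p ∈ L w → Sides w
        sides pw with Quad.through quad pw
        ... | inj₁ (q , qd , qa , _) = ⊥-elim (¬da (q , qd , qa))
        ... | inj₂ (inj₁ (q , qd , qb , _)) = ⊥-elim (¬db (q , qd , qb))
        ... | inj₂ (inj₂ (inj₁ (q , qd , qc , _))) = ⊥-elim (¬dc (q , qd , qc))
        ... | inj₂ (inj₂ (inj₂ (inj₁ h))) = inj₁ h
        ... | inj₂ (inj₂ (inj₂ (inj₂ (inj₁ h)))) = inj₂ (inj₁ h)
        ... | inj₂ (inj₂ (inj₂ (inj₂ (inj₂ h)))) = inj₂ (inj₂ h)

        swap : ∀ {i j k} → Concurrent i j k → Concurrent j i k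
        swap (q , qi , qj , qk) = q , qj , qi , qk

        same : ∀ {i j} → i ≢ j → Off i → Concurrent i j x → Concurrent i j y → ⊥
        same i≢j oi (q , qi , qj , qx) (q′ , qi′ , qj′ , qy) with meet-unique i≢j qi qj qi′ qj′
        ... | refl = meet-avoids px py x≢y oi qx qy qi

        go : Sides x → Sides y → ⊥
        go hx hy with Quad.unique quad | Quad.off quad
        ... | (da ∷ db ∷ dc ∷ []) ∷ (ab ∷ ac ∷ []) ∷ (bc ∷ []) ∷ [] ∷ [] | od ∷ oa ∷ ob ∷ oc ∷ [] = cases hx hy
          where
          apex-a : ∀ {y z} → p ∈ L y → p ∈ L z → y ≢ z → Concurrent a b y → Concurrent a c z → ⊥
          apex-a py pz y≢z h k = triangle-step ob oc oa od bc (≢-sym ab) (≢-sym ac) (≢-sym db) (≢-sym dc)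
            ¬db ¬dc py pz y≢z (swap h) (swap k)
          apex-b : ∀ {y z} → p ∈ L y → p ∈ L z → y ≢ z → Concurrent a b y → Concurrent b c z → ⊥
          apex-b py pz y≢z h k = triangle-step oa oc ob od ac ab (≢-sym bc) (≢-sym da) (≢-sym dc)
            ¬da ¬dc py pz y≢z h (swap k)
          apex-c : ∀ {y z} → p ∈ L y → p ∈ L z → y ≢ z → Concurrent a c y → Concurrent b c z → ⊥
          apex-c = triangle-step oa ob oc od ab ac bc (≢-sym da) (≢-sym db) ¬da ¬db

          cases : Sides x → Sides y → ⊥
          cases (inj₁ h) (inj₁ k) = same ab oa h k
          cases (inj₁ h) (inj₂ (inj₁ k)) = apex-a px py x≢y h k
          cases (inj₁ h) (inj₂ (inj₂ k)) = apex-b px py x≢y h k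
          cases (inj₂ (inj₁ h)) (inj₁ k) = apex-a py px (≢-sym x≢y) k h
          cases (inj₂ (inj₁ h)) (inj₂ (inj₁ k)) = same ac oa h k
          cases (inj₂ (inj₁ h)) (inj₂ (inj₂ k)) = apex-c px py x≢y h k
          cases (inj₂ (inj₂ h)) (inj₁ k) = apex-b py px (≢-sym x≢y) k h
          cases (inj₂ (inj₂ h)) (inj₂ (inj₁ k)) = apex-c py px (≢-sym x≢y) k h
          cases (inj₂ (inj₂ h)) (inj₂ (inj₂ k)) = same bc ob h k

      -- If both pairs of one of the three partitions into pairs meet, then p and the two meeting
      -- points form a transversal.
      disjointMeets : ∀ {a b c d} → Quad a b c d →
        CoveredBy 3 ⊎ (¬ Meet a b ⊎ ¬ Meet c d) × (¬ Meet a c ⊎ ¬ Meet b d) × (¬ Meet a d ⊎ ¬ Meet b c)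
      disjointMeets {a} {b} {c} {d} quad
        with both a b c d (λ h → h)
           | both a c b d (λ { (ha ∷ hc ∷ hb ∷ hd ∷ []) → ha ∷ hb ∷ hc ∷ hd ∷ [] })
           | both a d b c (λ { (ha ∷ hd ∷ hb ∷ hc ∷ []) → ha ∷ hb ∷ hc ∷ hd ∷ [] })
        where
        both : ∀ i j k l → (∀ {T} → All (Hits T) (i ∷ j ∷ k ∷ l ∷ []) → All (Hits T) (a ∷ b ∷ c ∷ d ∷ [])) →
          CoveredBy 3 ⊎ (¬ Meet i j ⊎ ¬ Meet k l)
        both i j k l f with meet? i j | meet? k l
        ... | no h | _ = inj₂ (inj₁ h)
        ... | yes _ | no h = inj₂ (inj₂ h)
        ... | yes (q , qi , qj) | yes (q′ , qk , ql) =
              inj₁ (p ∷ q ∷ q′ ∷ [] , refl , coverFromOff (Quad.all quad) #0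
                (f ((q , #1 , qi) ∷ (q , #1 , qj) ∷ (q′ , #2 , qk) ∷ (q′ , #2 , ql) ∷ [])))
      ... | inj₁ h | _ | _ = inj₁ h
      ... | inj₂ _ | inj₁ h | _ = inj₁ h
      ... | inj₂ _ | inj₂ _ | inj₁ h = inj₁ h
      ... | inj₂ h | inj₂ k | inj₂ l = inj₂ (h , k , l)

      -- If no two disjoint pairs of the four lines meet, the meeting pairs lie in a star or in a triangle.
      quad⇒CoveredBy3 : ∀ {a b c d} → Quad a b c d → CoveredBy 3
      quad⇒CoveredBy3 quad with disjointMeets quad
      ... | inj₁ h = h
      ... | inj₂ (inj₁ ab , inj₁ ac , inj₁ ad) = ⊥-elim (triangle quad ab ac ad)
      ... | inj₂ (inj₁ ab , inj₁ ac , inj₂ bc) = star (rotate (rotate (rotate quad))) ab ac bc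
      ... | inj₂ (inj₁ ab , inj₂ bd , inj₁ ad) = star (rotate (rotate quad)) (¬Meet-sym ad) (¬Meet-sym bd) ab
      ... | inj₂ (inj₁ ab , inj₂ bd , inj₂ bc) = ⊥-elim (triangle (rotate quad) bc bd (¬Meet-sym ab))
      ... | inj₂ (inj₂ cd , inj₁ ac , inj₁ ad) = star (rotate quad) cd (¬Meet-sym ac) (¬Meet-sym ad)
      ... | inj₂ (inj₂ cd , inj₁ ac , inj₂ bc) = ⊥-elim (triangle (rotate (rotate quad)) cd (¬Meet-sym ac) (¬Meet-sym bc))
      ... | inj₂ (inj₂ cd , inj₂ bd , inj₁ ad) = ⊥-elim (triangle (rotate (rotate (rotate quad)))
              (¬Meet-sym ad) (¬Meet-sym bd) (¬Meet-sym cd))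
      ... | inj₂ (inj₂ cd , inj₂ bd , inj₂ bc) = star quad bc bd cd

      -- If two of the lines meet, take p, their meeting point and a point of the third. If no two
      -- meet, then x, y, a, b, c form a packing of five lines, as x and y meet only in p.
      triple⇒CoveredBy3 : ∀ {a b c} → Unique (a ∷ b ∷ c ∷ []) → All Off (a ∷ b ∷ c ∷ []) →
        (∀ w → Off w → w ∈ₗ a ∷ b ∷ c ∷ []) → CoveredBy 3
      triple⇒CoveredBy3 {a} {b} {c} u os@(oa ∷ ob ∷ oc ∷ []) all
        with meet? a b | meet? a c | meet? b c
      ... | yes (q , qa , qb) | _ | _ = p ∷ q ∷ proj₁ (point c) ∷ [] , refl , coverFromOff all #0
              ((q , #1 , qa) ∷ (q , #1 , qb)
                ∷ (_ , #2 , proj₂ (point c)) ∷ [])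
      ... | no _ | yes (q , qa , qc) | _ = p ∷ q ∷ proj₁ (point b) ∷ [] , refl , coverFromOff all #0
              ((q , #1 , qa) ∷ (_ , #2 , proj₂ (point b))
                ∷ (q , #1 , qc) ∷ [])
      ... | no _ | no _ | yes (q , qb , qc) = p ∷ q ∷ proj₁ (point a) ∷ [] , refl , coverFromOff all #0
              ((_ , #2 , proj₂ (point a)) ∷ (q , #1 , qb)
                ∷ (q , #1 , qc) ∷ [])
      ... | no ¬ab | no ¬ac | no ¬bc = ⊥-elim (¬Packing₅
              ((≢-sym x≢y ∷ All.map (separated py) os) ∷ (All.map (separated px) os) ∷ u)
              ( ( ((λ (q , qx , qa , qy) → meet-avoids px py x≢y oa qx qy qa)
                    ∷ (λ (q , qx , qb , qy) → meet-avoids px py x≢y ob qx qy qb)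
                    ∷ (λ (q , qx , qc , qy) → meet-avoids px py x≢y oc qx qy qc) ∷ [])
                ∷ disjoint)
              , disjoint , off⇒Packing os u))
        where
        disjoint : ∀ {w} → AllPairs (λ i j → ¬ Concurrent i j w) (a ∷ b ∷ c ∷ [])
        disjoint = ((λ (q , qa , qb , _) → ¬ab (q , qa , qb)) ∷ (λ (q , qa , qc , _) → ¬ac (q , qa , qc)) ∷ [])
          ∷ ((λ (q , qb , qc , _) → ¬bc (q , qb , qc)) ∷ []) ∷ [] ∷ []

      -- The lines off p are listed one at a time. There are at most four, since five would form a
      -- packing.
      coveredBy3 : CoveredBy 3
      coveredBy3 with findOutside off? []
      -- Here and in the next case p is repeated only to reach length three.
      ... | inj₂ all = p ∷ p ∷ p ∷ [] , refl , coverFromOff all #0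
              []
      ... | inj₁ (a , oa , _) with findOutside off? (a ∷ [])
      ... | inj₂ all = p ∷ p ∷ proj₁ (point a) ∷ [] , refl , coverFromOff all #0
              ((_ , #2 , proj₂ (point a)) ∷ [])
      ... | inj₁ (b , ob , b∉) with findOutside off? (b ∷ a ∷ [])
      ... | inj₂ all = p ∷ proj₁ (point b) ∷ proj₁ (point a) ∷ [] , refl , coverFromOff all #0
              ((_ , #1 , proj₂ (point b)) ∷ (_ , #2 , proj₂ (point a)) ∷ [])
      ... | inj₁ (c , oc , c∉) with findOutside off? (c ∷ b ∷ a ∷ [])
      ... | inj₂ all = triple⇒CoveredBy3 (∉⇒All≢ c∉ ∷ ∉⇒All≢ b∉ ∷ [] ∷ []) (oc ∷ ob ∷ oa ∷ []) all
      ... | inj₁ (d , od , d∉) with findOutside off? (d ∷ c ∷ b ∷ a ∷ [])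
      ... | inj₂ all = quad⇒CoveredBy3 record
              { unique = ∉⇒All≢ d∉ ∷ ∉⇒All≢ c∉ ∷ ∉⇒All≢ b∉ ∷ [] ∷ [] ; off = od ∷ oc ∷ ob ∷ oa ∷ [] ; all = all }
      ... | inj₁ (e , oe , e∉) = ⊥-elim (¬Packing₅ u (off⇒Packing (oe ∷ od ∷ oc ∷ ob ∷ oa ∷ []) u))
        where u = ∉⇒All≢ e∉ ∷ ∉⇒All≢ d∉ ∷ ∉⇒All≢ c∉ ∷ ∉⇒All≢ b∉ ∷ [] ∷ []

    -- Lower bounds for the number of points.

    3r≤n+2 : ∀ {P} → Pencil P → 3 * r ≤ n + 2
    3r≤n+2 (pencil {p} {x} {y} {z} ((x≢y ∷ x≢z ∷ []) ∷ (y≢z ∷ []) ∷ [] ∷ []) (px ∷ py ∷ pz ∷ []) _) = begin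
      3 * r                                ≡⟨ arith₁ r ⟩
      r + (r + r)                          ≡⟨ cong₂ _+_ (sym (unif z)) (cong₂ _+_ (sym (unif x)) (sym (unif y))) ⟩
      ∣ L z ∣ + (∣ L x ∣ + ∣ L y ∣)        ≤⟨ +-monoʳ-≤ ∣ L z ∣ (∣p∣+∣q∣≤∣p∪q∣+k (L x) (L y) (L∩L≤1 x y x≢y)) ⟩
      ∣ L z ∣ + (∣ L x ∪ L y ∣ + 1)        ≡⟨ arith₂ (∣ L z ∣) (∣ L x ∪ L y ∣) ⟩
      -- The line z meets x and y in the same point p, so only one point is lost here, not two.
      ∣ L z ∣ + ∣ L x ∪ L y ∣ + 1          ≤⟨ +-monoˡ-≤ 1 (∣p∣+∣q∣≤∣p∪q∣+k (L z) (L x ∪ L y) meets-at-p) ⟩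
      ∣ L z ∪ (L x ∪ L y) ∣ + 1 + 1        ≡⟨ arith₃ (∣ L z ∪ (L x ∪ L y) ∣) ⟩
      ∣ L z ∪ (L x ∪ L y) ∣ + 2            ≤⟨ +-monoˡ-≤ 2 (∣p∣≤n (L z ∪ (L x ∪ L y))) ⟩
      n + 2                                ∎
      where
      open ≤-Reasoning
      arith₁ : ∀ r → 3 * r ≡ r + (r + r)
      arith₁ = solve-∀
      arith₂ : ∀ a b → a + (b + 1) ≡ a + b + 1
      arith₂ = solve-∀
      arith₃ : ∀ a → a + 1 + 1 ≡ a + 2
      arith₃ = solve-∀

      z∩xy⊆p : ∀ {q} → q ∈ L z ∩ (L x ∪ L y) → q ∈ ⁅ p ⁆
      z∩xy⊆p {q} q∈ with x∈p∩q⁻ (L z) (L x ∪ L y) q∈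
      ... | qz , qxy with x∈p∪q⁻ (L x) (L y) qxy
      ... | inj₁ qx = subst (λ s → q ∈ ⁅ s ⁆) (meet-unique x≢z qx qz px pz) (x∈⁅x⁆ q)
      ... | inj₂ qy = subst (λ s → q ∈ ⁅ s ⁆) (meet-unique y≢z qy qz py pz) (x∈⁅x⁆ q)

      meets-at-p : ∣ L z ∩ (L x ∪ L y) ∣ ≤ 1
      meets-at-p = ≤-trans (p⊆q⇒∣p∣≤∣q∣ z∩xy⊆p) (≤-reflexive (∣⁅x⁆∣≡1 p))

    -- Four lines cover at least 4r − 6 points, one more if c ∩ d = ∅, and q is a further point.
    4r≤n+4+k : ∀ {a b c d q k} → Unique (a ∷ b ∷ c ∷ d ∷ []) →
      q ∉ L a → q ∉ L b → q ∉ L c → q ∉ L d → ∣ L c ∩ L d ∣ ≤ k → 4 * r ≤ n + (4 + k)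
    4r≤n+4+k {a} {b} {c} {d} {q} {k}
      ((a≢b ∷ a≢c ∷ a≢d ∷ []) ∷ (b≢c ∷ b≢d ∷ []) ∷ _) qa qb qc qd c∩d≤k = s≤s⁻¹ (begin
      1 + 4 * r                            ≡⟨ arith₁ r ⟩
      1 + (r + (r + (r + r)))              ≡⟨ cong₂ _+_ (sym (∣⁅x⁆∣≡1 q)) (cong₂ _+_ (sym (unif a))
                                                (cong₂ _+_ (sym (unif b)) (cong₂ _+_ (sym (unif c)) (sym (unif d))))) ⟩
      ∣ ⁅ q ⁆ ∣ + (∣ A ∣ + (∣ B ∣ + (∣ C ∣ + ∣ D ∣)))
        ≤⟨ +-monoʳ-≤ ∣ ⁅ q ⁆ ∣ (+-monoʳ-≤ ∣ A ∣ (+-monoʳ-≤ ∣ B ∣ (∣p∣+∣q∣≤∣p∪q∣+k C D c∩d≤k))) ⟩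
      ∣ ⁅ q ⁆ ∣ + (∣ A ∣ + (∣ B ∣ + (∣ C ∪ D ∣ + k)))
        ≡⟨ arith₂ (∣ ⁅ q ⁆ ∣) (∣ A ∣) (∣ B ∣) (∣ C ∪ D ∣) k ⟩
      ∣ ⁅ q ⁆ ∣ + (∣ A ∣ + (∣ B ∣ + ∣ C ∪ D ∣)) + k
        ≤⟨ +-monoˡ-≤ k (+-monoʳ-≤ ∣ ⁅ q ⁆ ∣ (+-monoʳ-≤ ∣ A ∣ (∣p∣+∣q∣≤∣p∪q∣+k B (C ∪ D)
             (∣p∩[q∪s]∣≤j+k B C D (L∩L≤1 b c b≢c) (L∩L≤1 b d b≢d))))) ⟩
      ∣ ⁅ q ⁆ ∣ + (∣ A ∣ + (∣ B ∪ (C ∪ D) ∣ + 2)) + k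
        ≡⟨ arith₃ (∣ ⁅ q ⁆ ∣) (∣ A ∣) (∣ B ∪ (C ∪ D) ∣) k ⟩
      ∣ ⁅ q ⁆ ∣ + (∣ A ∣ + ∣ B ∪ (C ∪ D) ∣) + (2 + k)
        ≤⟨ +-monoˡ-≤ (2 + k) (+-monoʳ-≤ ∣ ⁅ q ⁆ ∣ (∣p∣+∣q∣≤∣p∪q∣+k A (B ∪ (C ∪ D))
             (∣p∩[q∪s]∣≤j+k A B (C ∪ D) (L∩L≤1 a b a≢b)
               (∣p∩[q∪s]∣≤j+k A C D (L∩L≤1 a c a≢c) (L∩L≤1 a d a≢d))))) ⟩
      ∣ ⁅ q ⁆ ∣ + (∣ U ∣ + 3) + (2 + k)
        ≡⟨ arith₄ (∣ ⁅ q ⁆ ∣) (∣ U ∣) k ⟩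
      ∣ ⁅ q ⁆ ∣ + ∣ U ∣ + (5 + k)
        ≤⟨ +-monoˡ-≤ (5 + k) (∣p∣+∣q∣≤∣p∪q∣+k ⁅ q ⁆ U (empty⇒∣p∣≤0 q∉U)) ⟩
      ∣ ⁅ q ⁆ ∪ U ∣ + 0 + (5 + k)
        ≤⟨ +-monoˡ-≤ (5 + k) (+-monoˡ-≤ 0 (∣p∣≤n (⁅ q ⁆ ∪ U))) ⟩
      n + 0 + (5 + k)                      ≡⟨ arith₅ n k ⟩
      1 + (n + (4 + k))                    ∎)
      where
      open ≤-Reasoning
      A = L a
      B = L b
      C = L c
      D = L d
      U = A ∪ (B ∪ (C ∪ D))
      arith₁ : ∀ r → 1 + 4 * r ≡ 1 + (r + (r + (r + r)))
      arith₁ = solve-∀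
      arith₂ : ∀ s a b c k → s + (a + (b + (c + k))) ≡ s + (a + (b + c)) + k
      arith₂ = solve-∀
      arith₃ : ∀ s a b k → s + (a + (b + 2)) + k ≡ s + (a + b) + (2 + k)
      arith₃ = solve-∀
      arith₄ : ∀ s a k → s + (a + 3) + (2 + k) ≡ s + a + (5 + k)
      arith₄ = solve-∀
      arith₅ : ∀ n k → n + 0 + (5 + k) ≡ 1 + (n + (4 + k))
      arith₅ = solve-∀

      q∉U : ¬ Nonempty (⁅ q ⁆ ∩ U)
      q∉U (s , s∈) with x∈p∩q⁻ ⁅ q ⁆ U s∈
      ... | s∈q , s∈U with x∈⁅y⁆⇒x≡y q s∈q
      ... | refl with x∈p∪q⁻ A (B ∪ (C ∪ D)) s∈U
      ... | inj₁ h = qa h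
      ... | inj₂ s∈BCD with x∈p∪q⁻ B (C ∪ D) s∈BCD
      ... | inj₁ h = qb h
      ... | inj₂ s∈CD with x∈p∪q⁻ C D s∈CD
      ... | inj₁ h = qc h
      ... | inj₂ h = qd h

    -- Second case: three lines through p and three lines through q off p.

    module TwoPencils {p q x₁ x₂ x₃ y₁ y₂ y₃}
      (x-unique : Unique (x₁ ∷ x₂ ∷ x₃ ∷ [])) (x∋p : All (λ i → p ∈ L i) (x₁ ∷ x₂ ∷ x₃ ∷ []))
      (q∉x₁ : q ∉ L x₁) (q∉x₂ : q ∉ L x₂)
      (y-unique : Unique (y₁ ∷ y₂ ∷ y₃ ∷ [])) (y∋q : All (λ i → q ∈ L i) (y₁ ∷ y₂ ∷ y₃ ∷ []))
      (y∌p : All (λ i → p ∉ L i) (y₁ ∷ y₂ ∷ y₃ ∷ []))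
      where

      px₁ : p ∈ L x₁
      px₁ = All.lookup x∋p #0

      px₂ : p ∈ L x₂
      px₂ = All.lookup x∋p #1

      x₁≢x₂ : x₁ ≢ x₂
      x₁≢x₂ = All.head (AllPairs.head x-unique)

      OnlyQ : Fin m → Set
      OnlyQ i = q ∈ L i × p ∉ L i

      Rest : Fin m → Set
      Rest i = p ∉ L i × q ∉ L i

      rest? : Decidable Rest
      rest? i = ¬? (p ∈? L i) ×-dec ¬? (q ∈? L i)

      -- The lines x₁, x₂, y, y′ form a packing: x₁ and x₂ meet only in p, which y and y′ miss, and
      -- y and y′ meet only in q, which x₁ and x₂ miss. As u misses p and q, it must pass through
      -- one of the four remaining intersections, the cells of the grid.
      grid : ∀ {u y y′} → Rest u → OnlyQ y → OnlyQ y′ → y ≢ y′ →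
        (Concurrent x₁ y u ⊎ Concurrent x₁ y′ u) ⊎ (Concurrent x₂ y u ⊎ Concurrent x₂ y′ u)
      grid {u} {y} {y′} (p∉u , q∉u) (qy , p∉y) (qy′ , p∉y′) y≢y′
        with throughPair {x₁} {x₂} {y} {y′} {u}
          ( (≢-sym (separated px₁ p∉u) ∷ ≢-sym (separated px₂ p∉u)
              ∷ ≢-sym (separated qy q∉u) ∷ ≢-sym (separated qy′ q∉u) ∷ [])
          ∷ (x₁≢x₂ ∷ separated px₁ p∉y ∷ separated px₁ p∉y′ ∷ [])
          ∷ (separated px₂ p∉y ∷ separated px₂ p∉y′ ∷ []) ∷ (y≢y′ ∷ []) ∷ [] ∷ [])
          ( ( ((λ (s , s₂ , sy , s₁) → meet-avoids px₁ px₂ x₁≢x₂ p∉y s₁ s₂ sy)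
                ∷ (λ (s , s₂ , sy , s₁) → meet-avoids px₁ px₂ x₁≢x₂ p∉y′ s₁ s₂ sy) ∷ [])
            ∷ ((λ (s , sy , sy′ , s₁) → meet-avoids qy qy′ y≢y′ q∉x₁ sy sy′ s₁) ∷ []) ∷ [] ∷ [])
          , ( ((λ (s , sy , sy′ , s₂) → meet-avoids qy qy′ y≢y′ q∉x₂ sy sy′ s₂) ∷ []) ∷ [] ∷ [])
          , ([] ∷ []) , [] , _)
      ... | inj₁ (s , s₁ , s₂ , su) = ⊥-elim (meet-avoids px₁ px₂ x₁≢x₂ p∉u s₁ s₂ su)
      ... | inj₂ (inj₁ h) = inj₁ (inj₁ h)
      ... | inj₂ (inj₂ (inj₁ h)) = inj₁ (inj₂ h)
      ... | inj₂ (inj₂ (inj₂ (inj₁ h))) = inj₂ (inj₁ h)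
      ... | inj₂ (inj₂ (inj₂ (inj₂ (inj₁ h)))) = inj₂ (inj₂ h)
      ... | inj₂ (inj₂ (inj₂ (inj₂ (inj₂ (s , sy , sy′ , su))))) = ⊥-elim (meet-avoids qy qy′ y≢y′ q∉u sy sy′ su)

      -- The lines x and u share at most one point, so both cells would be the same point, lying on
      -- y and y′. That point is q, which u misses.
      oneCell : ∀ {x u y y′} → p ∈ L x → Rest u → OnlyQ y → OnlyQ y′ → y ≢ y′ →
        Concurrent x y u → Concurrent x y′ u → ⊥
      oneCell px (p∉u , q∉u) (qy , _) (qy′ , _) y≢y′ (s , sx , sy , su) (s′ , sx′ , sy′ , su′)
        with meet-unique (separated px p∉u) sx su sx′ su′
      ... | refl = meet-avoids qy qy′ y≢y′ q∉u sy sy′ su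

      -- Otherwise u meets at most one cell of the grid, on x₂, and two lines through q avoid that cell.
      crosses : ∀ {u a b c} → Rest u → OnlyQ a → OnlyQ b → OnlyQ c → a ≢ b → a ≢ c → b ≢ c →
        Concurrent x₁ a u ⊎ Concurrent x₁ b u ⊎ Concurrent x₁ c u
      crosses ru qa qb qc a≢b a≢c b≢c with grid ru qa qb a≢b | grid ru qa qc a≢c | grid ru qb qc b≢c
      ... | inj₁ (inj₁ h) | _ | _ = inj₁ h
      ... | inj₁ (inj₂ h) | _ | _ = inj₂ (inj₁ h)
      ... | inj₂ _ | inj₁ (inj₁ h) | _ = inj₁ h
      ... | inj₂ _ | inj₁ (inj₂ h) | _ = inj₂ (inj₂ h)
      ... | inj₂ _ | inj₂ _ | inj₁ (inj₁ h) = inj₂ (inj₁ h)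
      ... | inj₂ _ | inj₂ _ | inj₁ (inj₂ h) = inj₂ (inj₂ h)
      ... | inj₂ (inj₁ h) | _ | inj₂ (inj₁ k) = ⊥-elim (oneCell px₂ ru qa qb a≢b h k)
      ... | inj₂ (inj₁ h) | _ | inj₂ (inj₂ k) = ⊥-elim (oneCell px₂ ru qa qc a≢c h k)
      ... | inj₂ (inj₂ h) | inj₂ (inj₁ k) | _ = ⊥-elim (oneCell px₂ ru qa qb a≢b k h)
      ... | inj₂ (inj₂ h) | inj₂ (inj₂ k) | _ = ⊥-elim (oneCell px₂ ru qb qc b≢c h k)

      -- `crosses` on three of the lines gives a cell of x₁ on u; leaving out the line of that cell
      -- and applying it to the other three gives a second cell, against `oneCell`.
      onlyQ≤3 : ∀ {u a b c d} → Rest u → OnlyQ a → OnlyQ b → OnlyQ c → OnlyQ d →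
        Unique (a ∷ b ∷ c ∷ d ∷ []) → ⊥
      onlyQ≤3 {u} ru qa qb qc qd ((ab ∷ ac ∷ ad ∷ []) ∷ (bc ∷ bd ∷ []) ∷ (cd ∷ []) ∷ [] ∷ [])
        with crosses ru qa qb qc ab ac bc
      ... | inj₁ h with crosses ru qb qc qd bc bd cd
      ...   | inj₁ k = oneCell px₁ ru qa qb ab h k
      ...   | inj₂ (inj₁ k) = oneCell px₁ ru qa qc ac h k
      ...   | inj₂ (inj₂ k) = oneCell px₁ ru qa qd ad h k
      onlyQ≤3 ru qa qb qc qd ((ab ∷ ac ∷ ad ∷ []) ∷ (bc ∷ bd ∷ []) ∷ (cd ∷ []) ∷ [] ∷ [])
          | inj₂ (inj₁ h) with crosses ru qa qc qd ac ad cd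
      ...   | inj₁ k = oneCell px₁ ru qa qb ab k h
      ...   | inj₂ (inj₁ k) = oneCell px₁ ru qb qc bc h k
      ...   | inj₂ (inj₂ k) = oneCell px₁ ru qb qd bd h k
      onlyQ≤3 ru qa qb qc qd ((ab ∷ ac ∷ ad ∷ []) ∷ (bc ∷ bd ∷ []) ∷ (cd ∷ []) ∷ [] ∷ [])
          | inj₂ (inj₂ h) with crosses ru qa qb qd ab ad bd
      ...   | inj₁ k = oneCell px₁ ru qa qc ac k h
      ...   | inj₂ (inj₁ k) = oneCell px₁ ru qb qc bc k h
      ...   | inj₂ (inj₂ k) = oneCell px₁ ru qc qd cd h k

      onlyQ : ∀ {y} → y ∈ₗ y₁ ∷ y₂ ∷ y₃ ∷ [] → OnlyQ y
      onlyQ y∈ = All.lookup y∋q y∈ , All.lookup y∌p y∈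

      onlyQ⇒y : ∀ {u} → Rest u → ∀ w → OnlyQ w → w ∈ₗ y₁ ∷ y₂ ∷ y₃ ∷ []
      onlyQ⇒y ru w qw = decidable-stable (w ∈ₗ? _) λ w∉ →
        onlyQ≤3 ru qw (onlyQ #0) (onlyQ #1) (onlyQ #2) (∉⇒All≢ w∉ ∷ y-unique)
        where
        open DecMembership _≟_ using () renaming (_∈?_ to _∈ₗ?_)

      -- The transversal consists of p and the three cells on x₁.
      coveredBy4 : ∀ {u} → Rest u → CoveredBy 4
      coveredBy4 ru
        with pointTowards x₁ y₁ (separated px₁ (proj₂ (onlyQ #0)))
           | pointTowards x₁ y₂ (separated px₁ (proj₂ (onlyQ #1)))
           | pointTowards x₁ y₃ (separated px₁ (proj₂ (onlyQ #2)))
      ... | α , αy , α! | β , βy , β! | γ , γy , γ! = T , refl , covers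
        where
        T = p ∷ α ∷ β ∷ γ ∷ []

        covers : Covers T
        covers w with p ∈? L w | q ∈? L w
        ... | yes pw | _ = p , #0 , pw
        ... | no p∉w | yes qw =
              All.lookup {P = Hits T} ((α , #1 , αy) ∷ (β , #2 , βy) ∷ (γ , #3 , γy) ∷ []) (onlyQ⇒y ru w (qw , p∉w))
        ... | no p∉w | no q∉w
          with crosses (p∉w , q∉w) (onlyQ #0) (onlyQ #1) (onlyQ #2)
                 (All.lookup (AllPairs.head y-unique) #0) (All.lookup (AllPairs.head y-unique) #1)
                 (All.head (AllPairs.head (AllPairs.tail y-unique)))
        ... | inj₁ (s , sx , sy , sw) = s , there (here (α! s sx sy)) , sw
        ... | inj₂ (inj₁ (s , sx , sy , sw)) = s , there (there (here (β! s sx sy))) , sw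
        ... | inj₂ (inj₂ (s , sx , sy , sw)) = s , there (there (there (here (γ! s sx sy)))) , sw

      -- The three families are disjoint: the first contains p, the second misses p but contains q,
      -- the third misses both.
      6+rest≤m : ∀ {zs} → Unique zs → All Rest zs → 6 + length zs ≤ m
      6+rest≤m u rs = unique⇒length≤ (++⁺ x-unique
        (++⁺ y-unique u λ (v∈y , v∈z) → proj₂ (All.lookup rs v∈z) (All.lookup y∋q v∈y))
        λ (v∈x , v∈yz) → All.lookup (All-++⁺ y∌p (All.map proj₁ rs)) v∈yz (All.lookup x∋p v∈x))

      -- A possible meeting point of c and d costs one point in the count, and k = 1 makes up for it
      -- by one more line.
      bound : ∀ {c d k} → c ≢ d → Rest c → Rest d → ∣ L c ∩ L d ∣ ≤ k → 8 + k ≤ m → 4 * suc r ≤ n + m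
      bound {c} {d} {k} c≢d (p∉c , q∉c) (p∉d , q∉d) c∩d≤k 8+k≤m = begin
        4 * suc r            ≡⟨ arith₁ r ⟩
        4 * r + 4            ≤⟨ +-monoˡ-≤ 4 (4r≤n+4+k
                                  ( (x₁≢x₂ ∷ separated px₁ p∉c ∷ separated px₁ p∉d ∷ [])
                                  ∷ (separated px₂ p∉c ∷ separated px₂ p∉d ∷ []) ∷ (c≢d ∷ []) ∷ [] ∷ [])
                                  q∉x₁ q∉x₂ q∉c q∉d c∩d≤k) ⟩
        n + (4 + k) + 4      ≡⟨ arith₂ n k ⟩
        n + (8 + k)          ≤⟨ +-monoʳ-≤ n 8+k≤m ⟩
        n + m                ∎
        where
        open ≤-Reasoning
        arith₁ : ∀ r → 4 * suc r ≡ 4 * r + 4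
        arith₁ = solve-∀
        arith₂ : ∀ n k → n + (4 + k) + 4 ≡ n + (8 + k)
        arith₂ = solve-∀

      coverFromRest : ∀ {s zs} → (∀ w → Rest w → w ∈ₗ zs) → All (λ w → s ∈ L w) zs → CoveredBy 3
      coverFromRest {s} {zs} all hits = p ∷ q ∷ s ∷ [] , refl , covers
        where
        covers : Covers (p ∷ q ∷ s ∷ [])
        covers w with p ∈? L w | q ∈? L w
        ... | yes pw | _ = p , #0 , pw
        ... | no _ | yes qw = q , #1 , qw
        ... | no p∉w | no q∉w = s , #2 , All.lookup hits (all w (p∉w , q∉w))

      -- Three points suffice if at most one line misses both p and q, or if exactly two do and they
      -- meet. The remaining cases have enough lines for `bound`.
      result : CoveredBy 3 ⊎ (CoveredBy 4 × 4 * suc r ≤ n + m)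
      result with findOutside rest? []
      -- No line is left for the third point, so any point serves; p is a filler.
      ... | inj₂ all = inj₁ (coverFromRest {p} all [])
      ... | inj₁ (c , rc , _) with findOutside rest? (c ∷ [])
      ... | inj₂ all = inj₁ (coverFromRest all (proj₂ (point c) ∷ []))
      ... | inj₁ (d , rd , d∉) with findOutside rest? (d ∷ c ∷ []) | meet? d c
      -- The lines d and c may meet, so k = 1, and e provides the ninth line.
      ... | inj₁ (e , re , e∉) | _ = inj₂ (coveredBy4 rc ,
              bound d≢c rd rc (L∩L≤1 d c d≢c) (6+rest≤m (∉⇒All≢ e∉ ∷ ∉⇒All≢ d∉ ∷ [] ∷ []) (re ∷ rd ∷ rc ∷ [])))
        where d≢c = All.lookup (∉⇒All≢ d∉) #0
      ... | inj₂ all | yes (s , sd , sc) = inj₁ (coverFromRest all (sd ∷ sc ∷ []))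
      -- The lines d and c are disjoint, so k = 0, and eight lines suffice.
      ... | inj₂ _ | no ¬dc = inj₂ (coveredBy4 rc ,
              bound (All.lookup (∉⇒All≢ d∉) #0) rd rc
                (empty⇒∣p∣≤0 λ (s , s∈) → ¬dc (s , x∈p∩q⁻ (L d) (L c) s∈))
                (6+rest≤m (∉⇒All≢ d∉ ∷ [] ∷ []) (rd ∷ rc ∷ [])))

    -- At most one of the three lines through p contains q, because two of them meet only in p,
    -- while y₁ contains q and misses p. The lines are reordered so that such a line comes third.
    twoPencils : ∀ {P} (X : Pencil P) → Pencil (λ i → Pencil.centre X ∉ L i) →
      CoveredBy 3 ⊎ (CoveredBy 4 × 4 * suc r ≤ n + m)
    twoPencils (pencil {p} {x₁} {x₂} {x₃} ux@((x₁≢x₂ ∷ x₁≢x₃ ∷ []) ∷ (x₂≢x₃ ∷ []) ∷ [] ∷ []) px@(p₁ ∷ p₂ ∷ p₃ ∷ []) _)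
      (pencil {q} uy qy@(qy₁ ∷ _) p∉y@(p∉y₁ ∷ _)) with q ∈? L x₁ | q ∈? L x₂
    ... | no q∉x₁ | no q∉x₂ = TwoPencils.result ux px q∉x₁ q∉x₂ uy qy p∉y
    ... | yes q₁  | _ = TwoPencils.result
            ((x₂≢x₃ ∷ ≢-sym x₁≢x₂ ∷ []) ∷ (≢-sym x₁≢x₃ ∷ []) ∷ [] ∷ []) (p₂ ∷ p₃ ∷ p₁ ∷ [])
            (λ q₂ → meet-avoids p₁ p₂ x₁≢x₂ p∉y₁ q₁ q₂ qy₁) (λ q₃ → meet-avoids p₁ p₃ x₁≢x₃ p∉y₁ q₁ q₃ qy₁) uy qy p∉y
    ... | no q∉x₁ | yes q₂ = TwoPencils.result
            ((x₁≢x₃ ∷ x₁≢x₂ ∷ []) ∷ (≢-sym x₂≢x₃ ∷ []) ∷ [] ∷ []) (p₁ ∷ p₃ ∷ p₂ ∷ [])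
            q∉x₁ (λ q₃ → meet-avoids p₂ p₃ x₂≢x₃ p∉y₁ q₂ q₃ qy₁) uy qy p∉y

-- The bound from the transversals and the counts.

theorem2p11 : (r n m : ℕ) → (L : Fin m → Subset n) → 2 ≤ r →
    IsLinear L → IsUniform r L → Isν₂ L 4 → 4 < m →
    (t : ℕ) → Isτ L t → t * suc r ≤ n + m
theorem2p11 r n m L 2≤r (_ , L∩L≤1) unif (_ , ν₂≤4) 4<m t isτ = conclude (findPencil {λ _ → ⊤} (λ _ → yes _))
  where
  open LinearSystem L L∩L≤1
  open Uniform (≤-trans (s≤s z≤n) 2≤r) unif ν₂≤4

  t≤ : ∀ {k} → CoveredBy k → t ≤ k
  t≤ (T , refl , c) = τ≤length isτ c

  3[1+r]≤n+m : Pencil (λ _ → ⊤) → 3 * suc r ≤ n + m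
  3[1+r]≤n+m X = begin
    3 * suc r      ≡⟨ arith₁ r ⟩
    3 * r + 3      ≤⟨ +-monoˡ-≤ 3 (3r≤n+2 X) ⟩
    n + 2 + 3      ≡⟨ arith₂ n ⟩
    -- The two points lost in the pencil and the three from passing to r + 1 are exactly paid for by
    -- the five lines.
    n + 5          ≤⟨ +-monoʳ-≤ n 4<m ⟩
    n + m          ∎
    where
    open ≤-Reasoning
    arith₁ : ∀ r → 3 * suc r ≡ 3 * r + 3
    arith₁ = solve-∀
    arith₂ : ∀ n → n + 2 + 3 ≡ n + 5
    arith₂ = solve-∀

  covered : ∀ {k} → CoveredBy k → k * suc r ≤ n + m → t * suc r ≤ n + m
  covered c = ≤-trans (*-monoˡ-≤ (suc r) (t≤ c))

  conclude : Pencil (λ _ → ⊤) ⊎ _ → t * suc r ≤ n + m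
  -- Without three concurrent lines the set of all lines is a 2-packing, of size m > 4.
  conclude (inj₂ none) = ⊥-elim (1+n≰n (≤-trans 4<m (≤-trans (≤-reflexive (sym (∣⊤∣≡n m)))
    (ν₂≤4 Subset.⊤ λ i j k _ _ _ i≢j i≢k j≢k p conc → none _ _ _ i≢j i≢k j≢k (p , conc)))))
  conclude (inj₁ X@(pencil ((x₁≢x₂ ∷ _) ∷ _) (px₁ ∷ px₂ ∷ _) _))
    with findPencil (λ i → ¬? (Pencil.centre X ∈? L i))
  ... | inj₂ offPacking = covered (OffPacking.coveredBy3 px₁ px₂ x₁≢x₂ offPacking) (3[1+r]≤n+m X)
  ... | inj₁ Y with twoPencils X Y
  ... | inj₁ c = covered c (3[1+r]≤n+m X)
  ... | inj₂ (c , b) = covered c b
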